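{- Let $n$ be an even positive integer, and let $a,b$ be distinct integers with $0<a,b<n$, $a$ even and $b$ odd, so that $G=C_{2n}(a,b,n)$ is a $5$-regular circulant graph. Then $G$ admits a factorization (in the sense described in the context) as a Cartesian product of a $3$-regular circulant graph and a $2$-regular circulant graph if and only if there exist positive integers $p,q$ with $p>2$, $1<q<n$, $p\mid a$, $q\mid b$, $pq=2n$ and $\gcd(p,q)=1$.
   Context: For an integer $m$ and a set $R$ of positive integers each at most $m/2$, the circulant graph $C_m(R)$ has vertex set $\{0,1,\dots,m-1\}$, with $i$ and $j$ adjacent iff $\min(|i-j|,\,m-|i-j|)\in R$; it is regular of degree $2|R|$ if $m/2\notin R$ and of degree $2|R|-1$ if $m/2\in R$. $C_{2n}(a,b,n)$ denotes the circulant graph on $2n$ vertices with jump set $\{a,b,n\}$. The Cartesian product $G_1\square G_2$ has vertex set $V(G_1)\times V(G_2)$, with $(u_1,v_1)\sim(u_2,v_2)$ iff either $u_1=u_2$ and $v_1v_2\in E(G_2)$, or $v_1=v_2$ and $u_1u_2\in E(G_1)$. The factorization theorem for circulant graphs states: if $p,q$ are relatively prime, $R\subseteq[1,p/2]$, $S\subseteq[1,q/2]$ and $T=qR\cup pS$ (where $qR=\{qr:r\in R\}$, $pS=\{ps:s\in S\}$), then $C_{pq}(T)\cong C_p(R)\square C_q(S)$. "$G=C_{2n}(a,b,n)$ admits a factorization as a Cartesian product of a $3$-regular and a $2$-regular circulant graph" means: there exist relatively prime integers $p,q>1$ with $pq=2n$ and sets of integers $R\subseteq[1,p/2]$, $S\subseteq[1,q/2]$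 with $qR\cup pS=\{a,b,n\}$, such that $C_p(R)$ is $3$-regular and $C_q(S)$ is $2$-regular (so that $G\cong C_p(R)\square C_q(S)$ by the factorization theorem). -}

module Defs where

open import Data.Fin.Base using (Fin; toℕ)
open import Data.List.Base using (List; length; filter; allFin; map; _++_)
open import Data.List.Membership.DecPropositional using (_∈?_)
open import Data.List.Membership.Propositional using (_∈_)
open import Data.List.Relation.Binary.BagAndSetEquality using (_∼[_]_; set)
open import Data.List.Relation.Unary.All using (All)
open import Data.Nat.Base using (ℕ; _*_; _∸_; _⊓_; _≤_; _<_; ∣_-_∣)
open import Data.Nat.Coprimality using (Coprime)
open import Data.Nat.Properties using (_≟_)
open import Data.Product.Base using (_×_; ∃-syntax)
open import Level using (0ℓ)
open import Relation.Binary.Core using (Rel)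
open import Relation.Binary.Definitions using (Decidable)
open import Relation.Binary.PropositionalEquality.Core using (_≡_)

-- A list of naturals stands for the finite set of its members; order and
-- repetition are irrelevant to everything below.

-- R ⊆ [1 , m/2], with m/2 the exact (possibly half-integral) quotient.
JumpSet : ℕ → List ℕ → Set
JumpSet m R = All (λ r → 1 ≤ r × 2 * r ≤ m) R

circularDistance : ∀ m → Fin m → Fin m → ℕ
circularDistance m i j = d ⊓ (m ∸ d)
  where d = ∣ toℕ i - toℕ j ∣

-- The adjacency relation of C_m(R).  It is always symmetric, and it is
-- loopless when JumpSet m R holds, since then 0 ∉ R.
CirculantAdj : ∀ m → List ℕ → Rel (Fin m) 0ℓ
CirculantAdj m R i j = circularDistance m i j ∈ R

circulantAdj? : ∀ m R → Decidable (CirculantAdj m R)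
circulantAdj? m R i j = _∈?_ _≟_ (circularDistance m i j) R

module _ {m : ℕ} {_~_ : Rel (Fin m) 0ℓ} (_~?_ : Decidable _~_) where

  degree : Fin m → ℕ
  degree i = length (filter (i ~?_) (allFin m))

  Regular : ℕ → Set
  Regular k = ∀ i → degree i ≡ k

-- C_m(T) factors as C_p(R) □ C_q(S), in the manner of the factorization
-- theorem for circulant graphs, with C_p(R) k-regular and C_q(S) l-regular.
AdmitsFactorization : (m : ℕ) (T : List ℕ) (k l : ℕ) → Set
AdmitsFactorization m T k l =
  ∃[ p ] ∃[ q ] ∃[ R ] ∃[ S ]
    1 < p × 1 < q × Coprime p q × p * q ≡ m ×
    JumpSet p R × JumpSet q S ×
    (map (q *_) R ++ map (p *_) S) ∼[ set ] T ×
    Regular (circulantAdj? p R) k × Regular (circulantAdj? q S) l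

-- Every vertex of C_m(R) has one neighbour at displacement r and, unless
-- 2r = m, a second one at −r.  So the degree is even when m is odd, and a
-- 3-regular factor C_p(R) forces p even and q odd.  Then pS consists of even
-- numbers other than n = q(p/2), which sends a to pS and b to qR.  Conversely
-- R = {b/q, p/2} and S = {a/p} work, q being odd as a divisor of b.

module Submission where

open import Defs
open import Data.Fin.Base using (Fin; toℕ; fromℕ<)
open import Data.Fin.Properties using (toℕ<n; toℕ-injective; toℕ-fromℕ<; nonZeroIndex)
open import Data.List.Base using (List; _∷_; []; _++_; length; filter; map; allFin; deduplicate)
open import Data.List.Membership.Propositional using (_∈_)
open import Data.List.Membership.Propositional.Properties
  using (∈-map⁺; ∈-map⁻; ∈-++⁺ˡ; ∈-++⁺ʳ; ∈-++⁻; ∈-filter⁺; ∈-filter⁻; ∈-allFin;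
         ∈-deduplicate⁺; ∈-deduplicate⁻)
open import Data.List.Membership.Propositional.Properties.WithK using (unique∧set⇒bag)
open import Data.List.Properties
  using (length-map; length-++; filter-all; filter-accept; filter-reject; filter-≐; map-∘; map-id-local)
open import Data.List.Relation.Binary.BagAndSetEquality using (_∼[_]_; set; ∼bag⇒↭)
open import Data.List.Relation.Binary.Permutation.Propositional.Properties using (↭-length)
open import Data.List.Relation.Unary.All as All using (All; []; _∷_)
open import Data.List.Relation.Unary.AllPairs.Core using ([]; _∷_)
open import Data.List.Relation.Unary.Any using (here; there)
open import Data.List.Relation.Unary.Unique.Propositional using (Unique)
import Data.List.Relation.Unary.Unique.Propositional.Properties as Unique
open import Data.Nat.Base
open import Data.Nat.Coprimality using (coprime⇒gcd≡1; gcd≡1⇒coprime)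
open import Data.Nat.Divisibility
open import Data.Nat.DivMod
open import Data.Nat.GCD using (gcd)
open import Data.Nat.Primality using (prime[2]; euclidsLemma)
open import Data.Nat.Properties
open import Data.Product.Base using (_×_; _,_; ∃-syntax; proj₁; proj₂)
open import Data.Sum.Base using (inj₁; inj₂)
open import Function.Base using (_∘_)
open import Function.Bundles using (_⇔_; mk⇔; Equivalence)
open import Relation.Binary.PropositionalEquality
open import Relation.Nullary.Decidable using (Dec; yes; no; from-no)
open import Relation.Nullary.Negation.Core using (¬_; contradiction)

open import Algebra.Properties.CommutativeSemigroup *-commutativeSemigroup using (x∙yz≈y∙xz)
open import Data.List.Relation.Unary.Unique.DecPropositional.Properties _≟_ using (deduplicate-!)

-- Doubling, and lengths of duplicate-free lists.

2*m≡m+m : ∀ m → 2 * m ≡ m + m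
2*m≡m+m m = cong (m +_) (+-identityʳ m)

unique∧set⇒length≡ : ∀ {a} {A : Set a} {xs ys : List A} →
  Unique xs → Unique ys → xs ∼[ set ] ys → length xs ≡ length ys
unique∧set⇒length≡ xs! ys! xs∼ys = ↭-length (∼bag⇒↭ (unique∧set⇒bag xs! ys! xs∼ys))

-- Vertices as residues relative to a base vertex.

module _ {m : ℕ} (i : Fin m) where

  private instance
    m≢0 : NonZero m
    m≢0 = nonZeroIndex i

  private
    i≤m : toℕ i ≤ m
    i≤m = <⇒≤ (toℕ<n i)

  -- The residue of j - i modulo m; adding `m ∸ toℕ i` avoids truncated subtraction.
  displacement : Fin m → ℕ
  displacement j = (toℕ j + (m ∸ toℕ i)) % m

  translate : ℕ → Fin m
  translate k = fromℕ< (m%n<n (k + toℕ i) m)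

  private
    [k%m+l]%m≡[k+l]%m : ∀ k l → (k % m + l) % m ≡ (k + l) % m
    [k%m+l]%m≡[k+l]%m k l = begin
      (k % m + l) % m          ≡⟨ %-distribˡ-+ (k % m) l m ⟩
      (k % m % m + l % m) % m  ≡⟨ cong (λ x → (x + l % m) % m) (m%n%n≡m%n k m) ⟩
      (k % m + l % m) % m      ≡⟨ %-distribˡ-+ k l m ⟨
      (k + l) % m              ∎
      where open ≡-Reasoning

    -- Shifting by x and then by y is one full turn. Both round trips between `displacement` and
    -- `translate` are instances, with i and m - i in either order.
    cancel : ∀ {k x y} → k < m → x + y ≡ m → ((k + x) % m + y) % m ≡ k
    cancel {k} {x} {y} k<m x+y≡m = begin
      ((k + x) % m + y) % m  ≡⟨ [k%m+l]%m≡[k+l]%m (k + x) y ⟩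
      (k + x + y) % m        ≡⟨ cong (_% m) (trans (+-assoc k x y) (cong (k +_) x+y≡m)) ⟩
      (k + m) % m            ≡⟨ [m+n]%n≡m%n k m ⟩
      k % m                  ≡⟨ m<n⇒m%n≡m k<m ⟩
      k                      ∎
      where open ≡-Reasoning

  translate∘displacement : ∀ j → translate (displacement j) ≡ j
  translate∘displacement j = toℕ-injective (trans (toℕ-fromℕ< _)
    (cancel (toℕ<n j) (m∸n+n≡m i≤m)))

  displacement∘translate : ∀ {k} → k < m → displacement (translate k) ≡ k
  displacement∘translate {k} k<m = trans
    (cong (λ x → (x + (m ∸ toℕ i)) % m) (toℕ-fromℕ< (m%n<n (k + toℕ i) m)))
    (cancel k<m (m+[n∸m]≡n i≤m))

  displacement-injective : ∀ {j k} → displacement j ≡ displacement k → j ≡ k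
  displacement-injective {j} {k} eq =
    trans (sym (translate∘displacement j)) (trans (cong translate eq) (translate∘displacement k))

  displacement<m : ∀ j → displacement j < m
  displacement<m j = m%n<n _ m

  -- The displacement is ∣i - j∣ when i ≤ j and m - ∣i - j∣ otherwise, and d ⊓ (m ∸ d) is unchanged
  -- when d is replaced by m - d.
  circularDistance-displacement : ∀ j →
    circularDistance m i j ≡ displacement j ⊓ (m ∸ displacement j)
  circularDistance-displacement j with ≤-<-connex (toℕ i) (toℕ j)
  ... | inj₁ i≤j = cong (λ d → d ⊓ (m ∸ d)) (begin
    ∣ toℕ i - toℕ j ∣              ≡⟨ m≤n⇒∣m-n∣≡n∸m i≤j ⟩
    toℕ j ∸ toℕ i                  ≡⟨ m<n⇒m%n≡m (≤-<-trans (m∸n≤m (toℕ j) (toℕ i)) (toℕ<n j)) ⟨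
    (toℕ j ∸ toℕ i) % m            ≡⟨ [m+n]%n≡m%n _ m ⟨
    (toℕ j ∸ toℕ i + m) % m        ≡⟨ cong (_% m) (begin
      toℕ j ∸ toℕ i + m              ≡⟨ +-∸-comm m i≤j ⟨
      toℕ j + m ∸ toℕ i              ≡⟨ +-∸-assoc (toℕ j) i≤m ⟩
      toℕ j + (m ∸ toℕ i)            ∎) ⟩
    displacement j                 ∎)
    where open ≡-Reasoning
  ... | inj₂ j<i = begin
    ∣ toℕ i - toℕ j ∣ ⊓ (m ∸ ∣ toℕ i - toℕ j ∣)  ≡⟨ cong (λ d → d ⊓ (m ∸ d)) (m≤n⇒∣n-m∣≡n∸m (<⇒≤ j<i)) ⟩
    d ⊓ (m ∸ d)                                  ≡⟨ ⊓-comm d (m ∸ d) ⟩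
    (m ∸ d) ⊓ d                                  ≡⟨ cong ((m ∸ d) ⊓_) (m∸[m∸n]≡n d≤m) ⟨
    (m ∸ d) ⊓ (m ∸ (m ∸ d))                      ≡⟨ cong (λ k → k ⊓ (m ∸ k)) m∸d≡displacement ⟩
    displacement j ⊓ (m ∸ displacement j)        ∎
    where
    open ≡-Reasoning
    d = toℕ i ∸ toℕ j
    d≤m : d ≤ m
    d≤m = ≤-trans (m∸n≤m (toℕ i) (toℕ j)) i≤m
    m∸d≡j+[m∸i] : m ∸ d ≡ toℕ j + (m ∸ toℕ i)
    m∸d≡j+[m∸i] = +-cancelʳ-≡ d _ _ (begin
      m ∸ d + d                          ≡⟨ m∸n+n≡m d≤m ⟩
      m                                  ≡⟨ m∸n+n≡m i≤m ⟨
      m ∸ toℕ i + toℕ i                  ≡⟨ cong (m ∸ toℕ i +_) (m+[n∸m]≡n (<⇒≤ j<i)) ⟨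
      m ∸ toℕ i + (toℕ j + d)            ≡⟨ +-assoc (m ∸ toℕ i) (toℕ j) d ⟨
      m ∸ toℕ i + toℕ j + d              ≡⟨ cong (_+ d) (+-comm (m ∸ toℕ i) (toℕ j)) ⟩
      toℕ j + (m ∸ toℕ i) + d            ∎)
    m∸d≡displacement : m ∸ d ≡ displacement j
    -- Since j < i, d is positive, so m ∸ d is already reduced modulo m.
    m∸d≡displacement = trans (sym (m<n⇒m%n≡m (∸-monoʳ-< (m<n⇒0<n∸m j<i) d≤m))) (cong (_% m) m∸d≡j+[m∸i])

-- Counting neighbours by their displacements.

properJump? : ∀ m r → Dec (2 * r < m)
properJump? m r = 2 * r <? m

properJumps : ℕ → List ℕ → List ℕ
properJumps m = filter (properJump? m)

-- The connection set R ∪ -R of the circulant graph, seen as a Cayley graph of the integers modulo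
-- m. Reflecting only the proper jumps keeps m/2, its own reflection, from being listed twice.
displacements : ℕ → List ℕ → List ℕ
displacements m R = R ++ map (m ∸_) (properJumps m R)

module _ {m : ℕ} {R : List ℕ} (jumps : JumpSet m R) where

  private
    0<r : ∀ {r} → r ∈ R → 0 < r
    0<r = proj₁ ∘ All.lookup jumps

    2r≤m : ∀ {r} → r ∈ R → 2 * r ≤ m
    2r≤m = proj₂ ∘ All.lookup jumps

    r≤m∸r : ∀ {r} → r ∈ R → r ≤ m ∸ r
    r≤m∸r {r} r∈R = m+n≤o⇒m≤o∸n r (subst (_≤ m) (2*m≡m+m r) (2r≤m r∈R))

    r≤m : ∀ {r} → r ∈ R → r ≤ m
    r≤m {r} r∈R = ≤-trans (m≤n*m r 2) (2r≤m r∈R)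

  displacements<m : ∀ {k} → k ∈ displacements m R → k < m
  displacements<m {k} k∈ with ∈-++⁻ R k∈
  ... | inj₁ k∈R = <-≤-trans (m<m*n k 2 {{>-nonZero (0<r k∈R)}} ≤-refl)
                     (subst (_≤ m) (*-comm 2 k) (2r≤m k∈R))
  ... | inj₂ k∈′ with r , r∈ , refl ← ∈-map⁻ (m ∸_) k∈′
                 with r∈R , _ ← ∈-filter⁻ (properJump? m) r∈ =
    ∸-monoʳ-< (0<r r∈R) (r≤m r∈R)

  ∈-displacements⁺ : ∀ {k} → k < m → k ⊓ (m ∸ k) ∈ R → k ∈ displacements m R
  ∈-displacements⁺ {k} k<m ⊓∈R with ⊓-sel k (m ∸ k)
  ... | inj₁ ≡k = ∈-++⁺ˡ (subst (_∈ R) ≡k ⊓∈R)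
  ... | inj₂ ≡m∸k with 2 * (m ∸ k) <? m
  ...   | yes 2r<m = ∈-++⁺ʳ R (subst (_∈ map (m ∸_) (properJumps m R)) (m∸[m∸n]≡n (<⇒≤ k<m))
                       (∈-map⁺ (m ∸_) (∈-filter⁺ (properJump? m) m∸k∈R 2r<m)))
    where m∸k∈R = subst (_∈ R) ≡m∸k ⊓∈R
  -- A jump that is not proper is exactly m/2, so k = m ∸ k and k itself lies in R.
  ...   | no 2r≮m = ∈-++⁺ˡ (subst (_∈ R) (sym k≡m∸k) m∸k∈R)
    where
    m∸k∈R = subst (_∈ R) ≡m∸k ⊓∈R
    k≡m∸k : k ≡ m ∸ k
    k≡m∸k = +-cancelʳ-≡ (m ∸ k) k (m ∸ k)
      (trans (m+[n∸m]≡n (<⇒≤ k<m))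
        (trans (≤-antisym (≮⇒≥ 2r≮m) (2r≤m m∸k∈R)) (2*m≡m+m (m ∸ k))))

  ∈-displacements⁻ : ∀ {k} → k ∈ displacements m R → k ⊓ (m ∸ k) ∈ R
  ∈-displacements⁻ {k} k∈ with ∈-++⁻ R k∈
  ... | inj₁ k∈R = subst (_∈ R) (sym (m≤n⇒m⊓n≡m (r≤m∸r k∈R))) k∈R
  ... | inj₂ k∈′ with r , r∈ , refl ← ∈-map⁻ (m ∸_) k∈′
                 with r∈R , _ ← ∈-filter⁻ (properJump? m) r∈ =
    subst (_∈ R) (sym (trans (cong ((m ∸ r) ⊓_) (m∸[m∸n]≡n (r≤m r∈R))) (m≥n⇒m⊓n≡n (r≤m∸r r∈R)))) r∈R

  -- Jumps are at most m/2, whereas reflections of proper jumps exceed m/2, so the two parts cannot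
  -- overlap.
  displacements-! : Unique R → Unique (displacements m R)
  displacements-! R! = Unique.++⁺ R! reflected! disjoint
    where
    proper = properJumps m R
    -- Reflection is involutive on [0, m], so map⁻ applies to the double
    -- reflection.
    reflected! : Unique (map (m ∸_) proper)
    reflected! = Unique.map⁻ {f = m ∸_} (subst Unique
      (sym (trans (sym (map-∘ proper)) (map-id-local (All.tabulate λ r∈ →
        m∸[m∸n]≡n (r≤m (proj₁ (∈-filter⁻ (properJump? m) r∈)))))))
      (Unique.filter⁺ (properJump? m) R!))
    disjoint : ∀ {k} → ¬ (k ∈ R × k ∈ map (m ∸_) proper)
    disjoint (k∈R , k∈′) with r , r∈ , refl ← ∈-map⁻ (m ∸_) k∈′
                         with r∈R , 2r<m ← ∈-filter⁻ (properJump? m) r∈ =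
      <-irrefl refl (begin-strict
        m ∸ r        ≤⟨ r≤m∸r k∈R ⟩
        m ∸ (m ∸ r)  ≡⟨ m∸[m∸n]≡n (r≤m r∈R) ⟩
        r            <⟨ m+n≤o⇒m≤o∸n (suc r) (subst (_< m) (2*m≡m+m r) 2r<m) ⟩
        m ∸ r        ∎)
      where open ≤-Reasoning

  -- The injection `displacement i` carries the neighbours of i onto `displacements m R`; both lists
  -- are duplicate-free, so their lengths agree.
  degree-circulant : Unique R → ∀ i →
    degree (circulantAdj? m R) i ≡ length R + length (properJumps m R)
  degree-circulant R! i = begin
    length neighbours                            ≡⟨ length-map (displacement i) neighbours ⟨
    length (map (displacement i) neighbours)     ≡⟨ unique∧set⇒length≡
                                                      (Unique.map⁺ (displacement-injective i)
                                                        (Unique.filter⁺ (circulantAdj? m R i) (Unique.allFin⁺ m)))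
                                                      (displacements-! R!) (mk⇔ to from) ⟩
    length (displacements m R)                   ≡⟨ length-++ R ⟩
    length R + length (map (m ∸_) (properJumps m R)) ≡⟨ cong (length R +_) (length-map (m ∸_) (properJumps m R)) ⟩
    length R + length (properJumps m R)          ∎
    where
    open ≡-Reasoning
    neighbours = filter (circulantAdj? m R i) (allFin m)
    to : ∀ {k} → k ∈ map (displacement i) neighbours → k ∈ displacements m R
    to k∈ with j , j∈ , refl ← ∈-map⁻ (displacement i) k∈ =
      ∈-displacements⁺ (displacement<m i j)
        (subst (_∈ R) (circularDistance-displacement i j)
          (proj₂ (∈-filter⁻ (circulantAdj? m R i) {xs = allFin m} j∈)))
    from : ∀ {k} → k ∈ displacements m R → k ∈ map (displacement i) neighbours
    from {k} k∈ = subst (_∈ map (displacement i) neighbours) d≡k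
      (∈-map⁺ (displacement i) (∈-filter⁺ (circulantAdj? m R i) (∈-allFin j)
        (subst (_∈ R) (sym (trans (circularDistance-displacement i j) (cong (λ d → d ⊓ (m ∸ d)) d≡k)))
          (∈-displacements⁻ k∈))))
      where
      j = translate i k
      d≡k : displacement i j ≡ k
      d≡k = displacement∘translate i (displacements<m k∈)

-- Parity of degrees, and small jump sets.

degree-cong : ∀ {m R R′} → R ∼[ set ] R′ → ∀ i →
  degree (circulantAdj? m R) i ≡ degree (circulantAdj? m R′) i
degree-cong {m} R∼R′ i = cong length
  (filter-≐ _ _ ((λ d∈ → Equivalence.to R∼R′ d∈) , (λ d∈ → Equivalence.from R∼R′ d∈)) (allFin m))

-- For odd m no jump satisfies 2r = m, so all jumps are proper and the two summands of the degree
-- coincide. Duplicates are removed first because the count is for distinct jumps.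
odd-order⇒even-degree : ∀ {m R} → ¬ 2 ∣ m → JumpSet m R → ∀ i → 2 ∣ degree (circulantAdj? m R) i
odd-order⇒even-degree {m} {R} 2∤m jumps i = divides (length R′) (begin
  degree (circulantAdj? m R) i           ≡⟨ degree-cong {m} (mk⇔ (∈-deduplicate⁺ _≟_) (∈-deduplicate⁻ _≟_ R)) i ⟩
  degree (circulantAdj? m R′) i          ≡⟨ degree-circulant jumps′ (deduplicate-! R) i ⟩
  length R′ + length (properJumps m R′)  ≡⟨ cong (λ xs → length R′ + length xs) (filter-all _ allProper) ⟩
  length R′ + length R′                  ≡⟨ 2*m≡m+m (length R′) ⟨
  2 * length R′                          ≡⟨ *-comm 2 (length R′) ⟩
  length R′ * 2                          ∎)
  where
  open ≡-Reasoning
  R′ = deduplicate _≟_ R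
  jumps′ : JumpSet m R′
  jumps′ = All.tabulate (All.lookup jumps ∘ ∈-deduplicate⁻ _≟_ R)
  allProper : All (λ r → 2 * r < m) R′
  allProper = All.map (λ {r} (_ , 2r≤m) → ≤∧≢⇒< 2r≤m λ { refl → 2∤m (m∣m*n r) }) jumps′

-- The jump h = m/2 contributes one neighbour; r differs from it, hence is proper and contributes
-- two.
halfJump-regular : ∀ {m r h} → JumpSet m (r ∷ h ∷ []) → 2 * h ≡ m → r ≢ h →
  Regular (circulantAdj? m (r ∷ h ∷ [])) 3
halfJump-regular {r = r} {h} jumps@((_ , 2r≤m) ∷ _) refl r≢h i =
  trans (degree-circulant jumps ((r≢h ∷ []) ∷ [] ∷ []) i)
    (cong (λ xs → 2 + length xs)
      (trans (filter-accept (properJump? (2 * h)) (≤∧≢⇒< 2r≤m (r≢h ∘ *-cancelˡ-≡ r h 2)))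
        (cong (r ∷_) (filter-reject (properJump? (2 * h)) (<-irrefl refl)))))

cycle-regular : ∀ {m s} → 0 < s → 2 * s < m → Regular (circulantAdj? m (s ∷ [])) 2
cycle-regular {m} 0<s 2s<m i =
  trans (degree-circulant ((0<s , <⇒≤ 2s<m) ∷ []) ([] ∷ []) i)
    (cong (λ xs → 1 + length xs) (filter-accept (properJump? m) 2s<m))

-- With no jumps every degree is 0, and 0 < m provides a vertex at which to see this.
2-regular⇒nonEmpty : ∀ {m S} → 0 < m → Regular (circulantAdj? m S) 2 → ∃[ s ] s ∈ S
2-regular⇒nonEmpty {S = s ∷ _} _ _ = s , here refl
2-regular⇒nonEmpty {S = []} 0<m regular
  with () ← trans (sym (regular (fromℕ< 0<m))) (degree-circulant [] [] (fromℕ< 0<m))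

-- The two directions of the equivalence.

rotate-∼ : ∀ {a} {A : Set a} {x y z : A} → (x ∷ y ∷ z ∷ []) ∼[ set ] (z ∷ x ∷ y ∷ [])
rotate-∼ = mk⇔
  (λ { (here eq)                 → there (here eq)
     ; (there (here eq))         → there (there (here eq))
     ; (there (there (here eq))) → here eq })
  (λ { (here eq)                 → there (there (here eq))
     ; (there (here eq))         → here eq
     ; (there (there (here eq))) → there (here eq) })

factorization⇒divisors : ∀ {n a b} → 2 ∣ n → ¬ 2 ∣ b →
  AdmitsFactorization (2 * n) (a ∷ b ∷ n ∷ []) 3 2 →
  ∃[ p ] ∃[ q ] 2 < p × 1 < q × q < n × p ∣ a × q ∣ b × p * q ≡ 2 * n × gcd p q ≡ 1
factorization⇒divisors {n} {a} {b} 2∣n 2∤b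
  (p , q , R , S , 1<p , 1<q , coprime , pq≡2n , jumpsR , jumpsS , T∼ , regularR , regularS) =
  p , q , 2<p , 1<q , q<n , p∣a , q∣b , pq≡2n , coprime⇒gcd≡1 coprime
  where
  2∣p : 2 ∣ p
  2∣p with 2 ∣? p
  ... | yes 2∣p = 2∣p
  ... | no  2∤p = contradiction
    (subst (2 ∣_) (regularR i) (odd-order⇒even-degree 2∤p jumpsR i)) (from-no (2 ∣? 3))
    where i = fromℕ< (<-trans z<s 1<p)

  2∤q : ¬ 2 ∣ q
  2∤q 2∣q with () ← coprime (2∣p , 2∣q)

  2<p : 2 < p
  -- If p were 2, then q = n, which is even.
  2<p = ≤∧≢⇒< 1<p λ { refl → 2∤q (subst (2 ∣_) (sym (*-cancelˡ-≡ q n 2 pq≡2n)) 2∣n) }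

  q<n : q < n
  q<n = *-cancelˡ-< 2 q n
    (subst (2 * q <_) pq≡2n (*-monoˡ-< q {{>-nonZero (<-trans z<s 1<q)}} 2<p))

  p∣a : p ∣ a
  -- Any s in S serves: p * s is a, b or n. It is even, so it is not b, and p * s = n would give q =
  -- 2 * s, contradicting that q is odd.
  p∣a with s , s∈S ← 2-regular⇒nonEmpty (<-trans z<s 1<q) regularS
      with Equivalence.to T∼ (∈-++⁺ʳ (map (q *_) R) (∈-map⁺ (p *_) s∈S))
  ... | here ps≡a = subst (p ∣_) ps≡a (m∣m*n s)
  ... | there (here ps≡b) = contradiction (subst (2 ∣_) ps≡b (∣m⇒∣m*n s 2∣p)) 2∤b
  ... | there (there (here ps≡n)) = contradiction (subst (2 ∣_) (sym q≡2s) (m∣m*n s)) 2∤q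
    where
    open ≡-Reasoning
    q≡2s : q ≡ 2 * s
    q≡2s = *-cancelˡ-≡ q (2 * s) p {{>-nonZero (<-trans z<s 1<p)}} (begin
      p * q        ≡⟨ pq≡2n ⟩
      2 * n        ≡⟨ cong (2 *_) ps≡n ⟨
      2 * (p * s)  ≡⟨ x∙yz≈y∙xz 2 p s ⟩
      p * (2 * s)  ∎)

  q∣b : q ∣ b
  q∣b with ∈-++⁻ (map (q *_) R) (Equivalence.from T∼ (there (here refl)))
  ... | inj₁ b∈qR with r , _ , b≡qr ← ∈-map⁻ (q *_) b∈qR = subst (q ∣_) (sym b≡qr) (m∣m*n r)
  -- Every element of pS is a multiple of the even number p, so the odd b cannot lie there.
  ... | inj₂ b∈pS with s , _ , b≡ps ← ∈-map⁻ (p *_) b∈pS =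
    contradiction (subst (2 ∣_) (sym b≡ps) (∣m⇒∣m*n s 2∣p)) 2∤b

divisors⇒factorization : ∀ {n a b} → 0 < a → a < n → 0 < b → b < n → ¬ 2 ∣ b →
  (∃[ p ] ∃[ q ] 2 < p × 1 < q × q < n × p ∣ a × q ∣ b × p * q ≡ 2 * n × gcd p q ≡ 1) →
  AdmitsFactorization (2 * n) (a ∷ b ∷ n ∷ []) 3 2
divisors⇒factorization {n} 0<a a<n 0<b b<n 2∤b
  (p , q , 2<p , 1<q , _ , divides s refl , divides r refl , pq≡2n , gcd≡1)
  with euclidsLemma p q prime[2] (subst (2 ∣_) (sym pq≡2n) (m∣m*n n))
-- Here b = r * q, so an even q would make b even.
... | inj₂ 2∣q = contradiction (∣n⇒∣m*n r 2∣q) 2∤b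
... | inj₁ (divides h p≡h*2) =
  p , q , r ∷ h ∷ [] , s ∷ [] , <-trans (s<s z<s) 2<p , 1<q , gcd≡1⇒coprime gcd≡1 , pq≡2n ,
  jumps , (0<s , <⇒≤ 2s<q) ∷ [] ,
  -- Up to commuting factors, qR followed by pS reads b, n, a; the rotation puts a first.
  subst₂ (λ x T → (x ∷ q * h ∷ p * s ∷ []) ∼[ set ] T)
    (*-comm r q) (cong₂ (λ x y → x ∷ r * q ∷ y ∷ []) (*-comm p s) (trans (*-comm q h) hq≡n)) rotate-∼ ,
  halfJump-regular jumps 2h≡p (<⇒≢ r<h) , cycle-regular 0<s 2s<q
  where
  2h≡p : 2 * h ≡ p
  2h≡p = trans (*-comm 2 h) (sym p≡h*2)

  hq≡n : h * q ≡ n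
  hq≡n = *-cancelˡ-≡ (h * q) n 2 (trans (sym (*-assoc 2 h q)) (trans (cong (_* q) 2h≡p) pq≡2n))

  r<h : r < h
  -- Cancel q in b = r * q < h * q = n.
  r<h = *-cancelʳ-< q r h (subst (r * q <_) (sym hq≡n) b<n)

  0<r : 0 < r
  0<r = *-cancelʳ-< q 0 r 0<b

  0<s : 0 < s
  0<s = *-cancelʳ-< p 0 s 0<a

  2s<q : 2 * s < q
  -- Strictness comes from a < n: it keeps s away from q/2, so the second factor has degree 2 and
  -- not 1.
  2s<q = *-cancelʳ-< p (2 * s) q (begin-strict
    2 * s * p    ≡⟨ *-assoc 2 s p ⟩
    2 * (s * p)  <⟨ *-monoʳ-< 2 a<n ⟩
    2 * n        ≡⟨ pq≡2n ⟨
    p * q        ≡⟨ *-comm p q ⟩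
    q * p        ∎)
    where open ≤-Reasoning

  jumps : JumpSet p (r ∷ h ∷ [])
  jumps = (0<r , subst (2 * r ≤_) 2h≡p (*-monoʳ-≤ 2 (<⇒≤ r<h)))
        ∷ (<-trans 0<r r<h , ≤-reflexive 2h≡p) ∷ []

theorem31 : (n a b : ℕ) → 0 < n → 2 ∣ n →
    a ≢ b → 0 < a → a < n → 0 < b → b < n → 2 ∣ a → ¬ (2 ∣ b) →
    AdmitsFactorization (2 * n) (a ∷ b ∷ n ∷ []) 3 2
      ⇔
    (∃[ p ] ∃[ q ] 2 < p × 1 < q × q < n × p ∣ a × q ∣ b × p * q ≡ 2 * n × gcd p q ≡ 1)
theorem31 n a b _ 2∣n _ 0<a a<n 0<b b<n _ 2∤b =
  mk⇔ (factorization⇒divisors 2∣n 2∤b) (divisors⇒factorization 0<a a<n 0<b b<n 2∤b)
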